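{- Let ${}^*\mathbb{Z}=\mathbb{Z}^I/\mathcal{U}$ be an ultrapower of $\mathbb{Z}$ with respect to a nonprincipal ultrafilter $\mathcal{U}$ on a countably infinite set $I$. The map $\mathfrak{m}\mapsto\mathcal{F}(\mathfrak{m})$ is a one-to-one correspondence between the maximal ideals of ${}^*\mathbb{Z}$ and the maximal filters on $\operatorname{pr}({}^*\mathbb{Z})$. Moreover, for a maximal ideal $\mathfrak{m}$, $\mathcal{F}(\mathfrak{m})$ is principal if and only if $\mathfrak{m}=p\,{}^*\mathbb{Z}$ for some $p\in\mathcal{P}({}^*\mathbb{N})$.
   Context: ${}^*\mathbb{N}=\mathbb{N}^I/\mathcal{U}$. For $x,y\in{}^*\mathbb{Z}$, $x\mid y$ means $y=zx$ for some $z\in{}^*\mathbb{Z}$. $\mathcal{P}({}^*\mathbb{N})$ is the set of $p\in{}^*\mathbb{N}$, $p\neq1$, whose only divisors in ${}^*\mathbb{Z}$ are $\pm1,\pm p$. For $n\in{}^*\mathbb{Z}$, $\operatorname{pr}(n)=\{p\in\mathcal{P}({}^*\mathbb{N}):p\mid n\}$ and $\operatorname{pr}({}^*\mathbb{Z})=\{\operatorname{pr}(n):n\in{}^*\mathbb{Z}\}$. A filter on $\operatorname{pr}({}^*\mathbb{Z})$ is $\mathcal{F}\subseteq\operatorname{pr}({}^*\mathbb{Z})$ with (a) $\emptyset\notin\mathcal{F}$; (b) closed under intersections of two members; (c) if $\operatorname{pr}(n)\in\mathcal{F}$ and $\operatorname{pr}(n)\subseteq\operatorname{pr}(m)$ then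 $\operatorname{pr}(m)\in\mathcal{F}$. It is maximal if no filter properly contains it, and principal if there is $n\in{}^*\mathbb{Z}$ such that for $S\in\operatorname{pr}({}^*\mathbb{Z})$, $S\in\mathcal{F}$ iff $\operatorname{pr}(n)\subseteq S$. For an ideal $J$, $\mathcal{F}(J)=\{\operatorname{pr}(n):n\in J\}$. -}

module Defs where

open import Algebra.Bundles using (CommutativeRing)
import Algebra.Construct.Pointwise as Pointwise
import Algebra.Definitions.RawMagma as RawMagmaDefs
open import Data.Integer.Base as ℤ using (ℤ; +_)
import Data.Integer.Properties as ℤₚ
open import Data.Nat.Base using (ℕ)
open import Data.Product.Base using (Σ; ∃; _×_; _,_; proj₁)
open import Data.Sum.Base using (_⊎_)
open import Function.Base using (_on_)
open import Function.Bundles using (_⇔_)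
open import Level using (0ℓ; suc)
open import Relation.Binary.Core using (Rel)
open import Relation.Binary.PropositionalEquality.Core
  using (_≡_; refl; sym; trans; cong; cong₂)
open import Relation.Nullary.Negation.Core using (¬_)
open import Relation.Unary using (Pred; _∈_; _∉_; _⊆_; _≐_; _∩_; ∅; ∁)
  renaming (U to Full)

------------------------------------------------------------------------
-- Ultrafilters.  Here and below, a set of subsets of X is a predicate on
-- Pred X 0ℓ.

record IsUltrafilter {I : Set} (𝒰 : Pred (Pred I 0ℓ) 0ℓ) : Set₁ where
  field
    full   : Full ∈ 𝒰
    empty  : ∅ ∉ 𝒰
    upward : ∀ {A B} → A ⊆ B → A ∈ 𝒰 → B ∈ 𝒰
    inter  : ∀ {A B} → A ∈ 𝒰 → B ∈ 𝒰 → (A ∩ B) ∈ 𝒰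
    ultra  : ∀ A → A ∈ 𝒰 ⊎ ∁ A ∈ 𝒰

Nonprincipal : {I : Set} → Pred (Pred I 0ℓ) 0ℓ → Set₁
Nonprincipal {I} 𝒰 = ¬ (Σ I λ i → 𝒰 ≐ (λ A → i ∈ A))

------------------------------------------------------------------------
-- Ideals of a commutative ring.

module Ideals (R : CommutativeRing 0ℓ 0ℓ) where
  open CommutativeRing R
  open RawMagmaDefs *-rawMagma public using (_∣_)

  record IsIdeal (J : Pred Carrier 0ℓ) : Set where
    field
      resp     : ∀ {x y} → x ≈ y → x ∈ J → y ∈ J
      0#∈      : 0# ∈ J
      +-closed : ∀ {x y} → x ∈ J → y ∈ J → (x + y) ∈ J
      *-absorb : ∀ r {x} → x ∈ J → (r * x) ∈ J

  record IsMaximalIdeal (J : Pred Carrier 0ℓ) : Set₁ where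
    field
      isIdeal : IsIdeal J
      proper  : 1# ∉ J
      maximal : ∀ {K} → IsIdeal K → 1# ∉ K → J ⊆ K → K ⊆ J

  principalIdeal : Carrier → Pred Carrier 0ℓ
  principalIdeal a = a ∣_

------------------------------------------------------------------------
-- Ultrapowers: an element is represented by a function on I, and
-- equality in the ultrapower is agreement on a member of 𝒰.

module Ultrapower {I : Set} (𝒰 : Pred (Pred I 0ℓ) 0ℓ)
                  (isUltrafilter : IsUltrafilter 𝒰) where
  open IsUltrafilter isUltrafilter

  infix 4 _≋_
  _≋_ : {A : Set} → Rel (I → A) 0ℓ
  x ≋ y = (λ i → x i ≡ y i) ∈ 𝒰

  private
    ptwise : {A : Set} {x y : I → A} → (∀ i → x i ≡ y i) → x ≋ y
    ptwise h = upward (λ {i} _ → h i) full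

    module P = CommutativeRing (Pointwise.commutativeRing I ℤₚ.+-*-commutativeRing)

  *ℤ-commutativeRing : CommutativeRing 0ℓ 0ℓ
  *ℤ-commutativeRing = record
    { Carrier = I → ℤ
    ; _≈_ = _≋_
    ; _+_ = P._+_
    ; _*_ = P._*_
    ; -_ = P.-_
    ; 0# = P.0#
    ; 1# = P.1#
    ; isCommutativeRing = record
      { isRing = record
        { +-isAbelianGroup = record
          { isGroup = record
            { isMonoid = record
              { isSemigroup = record
                { isMagma = record
                  { isEquivalence = record
                    { refl  = ptwise (λ _ → refl)
                    ; sym   = upward sym
                    ; trans = λ p q → upward (λ (e , f) → trans e f) (inter p q)
                    }
                  ; ∙-cong = λ p q → upward (λ (e , f) → cong₂ ℤ._+_ e f) (inter p q)
                  }
                ; assoc = λ x y z → ptwise (P.+-assoc x y z)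
                }
              ; identity = (λ x → ptwise (P.+-identityˡ x))
                         , (λ x → ptwise (P.+-identityʳ x))
              }
            ; inverse = (λ x → ptwise (P.-‿inverseˡ x))
                      , (λ x → ptwise (P.-‿inverseʳ x))
            ; ⁻¹-cong = upward (cong (λ a → ℤ.- a))
            }
          ; comm = λ x y → ptwise (P.+-comm x y)
          }
        ; *-cong = λ p q → upward (λ (e , f) → cong₂ ℤ._*_ e f) (inter p q)
        ; *-assoc = λ x y z → ptwise (P.*-assoc x y z)
        ; *-identity = (λ x → ptwise (P.*-identityˡ x))
                     , (λ x → ptwise (P.*-identityʳ x))
        ; distrib = (λ x y z → ptwise (P.distribˡ x y z))
                  , (λ x y z → ptwise (P.distribʳ x y z))
        }
      ; *-comm = λ x y → ptwise (P.*-comm x y)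
      }
    }

  open CommutativeRing *ℤ-commutativeRing public
    using (_≈_; _+_; _*_; -_; 0#; 1#) renaming (Carrier to *ℤ)
  open Ideals *ℤ-commutativeRing public

  *ℕ : Set
  *ℕ = I → ℕ

  ι : *ℕ → *ℤ
  ι p i = + p i

  𝒫 : Pred *ℕ 0ℓ
  𝒫 p = ¬ (p ≋ λ _ → 1)
      × (∀ d → d ∣ ι p → d ≈ 1# ⊎ d ≈ - 1# ⊎ d ≈ ι p ⊎ d ≈ - ι p)

  pr : *ℤ → Pred *ℕ 0ℓ
  pr n p = p ∈ 𝒫 × ι p ∣ n

  pr[*ℤ] : Pred (Pred *ℕ 0ℓ) 0ℓ
  pr[*ℤ] S = ∃ λ n → S ≐ pr n

  -- The empty family is allowed; `resp` says that ℱ does not distinguish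
  -- extensionally equal sets.
  record IsFilter (ℱ : Pred (Pred *ℕ 0ℓ) 0ℓ) : Set₁ where
    field
      ⊆pr[*ℤ]  : ℱ ⊆ pr[*ℤ]
      resp     : ∀ {S T} → S ≐ T → S ∈ ℱ → T ∈ ℱ
      ∅∉       : ∅ ∉ ℱ
      ∩-closed : ∀ {S T} → S ∈ ℱ → T ∈ ℱ → (S ∩ T) ∈ ℱ
      upward   : ∀ {n m} → pr n ∈ ℱ → pr n ⊆ pr m → pr m ∈ ℱ

  -- "No filter properly contains ℱ", in the order-theoretic form.
  record IsMaximalFilter (ℱ : Pred (Pred *ℕ 0ℓ) 0ℓ) : Set₁ where
    field
      isFilter : IsFilter ℱ
      maximal  : ∀ {𝒢} → IsFilter 𝒢 → ℱ ⊆ 𝒢 → 𝒢 ⊆ ℱ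

  IsPrincipal : Pred (Pred *ℕ 0ℓ) 0ℓ → Set₁
  IsPrincipal ℱ = ∃ λ n → ∀ S → S ∈ pr[*ℤ] → S ∈ ℱ ⇔ pr n ⊆ S

  𝓕 : Pred *ℤ 0ℓ → Pred (Pred *ℕ 0ℓ) 0ℓ
  𝓕 J S = ∃ λ n → n ∈ J × S ≐ pr n

  MaximalIdeal : Set₁
  MaximalIdeal = Σ (Pred *ℤ 0ℓ) IsMaximalIdeal

  MaximalFilter : Set₁
  MaximalFilter = Σ (Pred (Pred *ℕ 0ℓ) 0ℓ) IsMaximalFilter

  _≐ᴵ_ : Rel MaximalIdeal 0ℓ
  _≐ᴵ_ = _≐_ on proj₁

  _≐ᶠ_ : Rel MaximalFilter (suc 0ℓ)
  _≐ᶠ_ = _≐_ on proj₁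

{-# OPTIONS --safe #-}

-- Two facts about the Bézout domain *ℤ carry the argument: the gcd of n and m
-- lies in every ideal containing both and satisfies pr (gcd n m) ≐ pr n ∩ pr m,
-- and n is a unit as soon as pr n is empty.  Hence if n ∈ 𝔪 and pr n ⊆ pr m,
-- then m ∈ 𝔪: otherwise 1 = a + b m with a ∈ 𝔪, so pr a ∩ pr m = ∅, the gcd of
-- n and a has no prime divisor, and 𝔪 contains a unit.  The inverse of 𝓕 is
-- ℱ ↦ { n | pr n ∈ ℱ }, and any prime divisor p of a generator of a principal
-- 𝓕 𝔪 satisfies 𝔪 ⊆ p *ℤ.
module Submission where

open import Defs
open import Data.Nat.Base using (ℕ)
open import Data.Product using (Σ; ∃; _×_; proj₁; map)
open import Function.Bundles using (_⤖_; _⇔_)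
open import Function.Structures using (IsBijection)
open import Level using (0ℓ)
open import Relation.Unary using (Pred; _∈_; _≐_)

open import Algebra.Bundles using (CommutativeRing)
import Algebra.Properties.CommutativeSemigroup as CommutativeSemigroupProperties
import Algebra.Properties.Semiring.Divisibility as SemiringDivisibility
open import Data.Integer.Base as ℤ using (+_; -[1+_])
import Data.Integer.Divisibility.Signed as ℤ∣
import Data.Integer.Properties as ℤₚ
open import Data.List.Base using ([]; _∷_)
open import Data.List.Relation.Unary.All using (_∷_)
import Data.Nat.Base as ℕ
open import Data.Nat.Divisibility using (m∣m*n; n∣m*n; _∣0; ∣1⇒≡1; ∣-reflexive)
  renaming (_∣_ to _∣ℕ_)
open import Data.Nat.GCD using (module GCD; module Bézout)
open import Data.Nat.Primality
  using (Prime; prime[2]; ¬prime[1]; prime⇒irreducible)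
open import Data.Nat.Primality.Factorisation using (factorise)
open import Data.Product using (_,_; proj₂)
open import Data.Sum.Base as Sum using (_⊎_; inj₁; inj₂; [_,_]′)
open import Function.Base using (_∘_; id)
open import Function.Bundles using (Equivalence; mk⇔)
open import Relation.Binary.PropositionalEquality.Core
  using (_≡_; _≢_; refl; sym; trans; cong; subst)
open import Relation.Nullary.Decidable.Core using (yes; no)
open import Relation.Nullary.Negation.Core using (¬_; contradiction)
open import Relation.Unary using (_⊆_; _∩_; _∪_; ∅)
open import Relation.Unary.Algebra using (∩-comm; ∩-cong)
open import Relation.Unary.Properties using (≐-refl; ≐-sym; ≐-trans)

-- Sums of ideals in a commutative ring.

module IdealProperties (R : CommutativeRing 0ℓ 0ℓ) where
  open CommutativeRing R renaming (refl to ≈-refl; sym to ≈-sym; trans to ≈-trans)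
  open Ideals R
  open SemiringDivisibility semiring using (∣ʳ-respʳ-≈; x∣ʳy⇒x∣ʳzy; _,_)
    renaming (_∣0 to _∣0#)

  ∣-closed : ∀ {J x y} → IsIdeal J → x ∣ y → x ∈ J → y ∈ J
  ∣-closed isIdeal (q , qx≈y) x∈J = resp qx≈y (*-absorb q x∈J)
    where open IsIdeal isIdeal

  principalIdeal-isIdeal : ∀ a → IsIdeal (principalIdeal a)
  principalIdeal-isIdeal a = record
    { resp     = ∣ʳ-respʳ-≈
    ; 0#∈      = a ∣0#
    ; +-closed = λ (q , qa≈x) (r , ra≈y) →
        q + r , ≈-trans (distribʳ a q r) (+-cong qa≈x ra≈y)
    ; *-absorb = λ r → x∣ʳy⇒x∣ʳzy r
    }

  infixl 6 _⊕_
  _⊕_ : Pred Carrier 0ℓ → Pred Carrier 0ℓ → Pred Carrier 0ℓ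
  (J ⊕ K) x = ∃ λ a → ∃ λ b → a ∈ J × b ∈ K × a + b ≈ x

  ⊕-isIdeal : ∀ {J K} → IsIdeal J → IsIdeal K → IsIdeal (J ⊕ K)
  ⊕-isIdeal isIdealJ isIdealK = record
    { resp     = λ x≈y (a , b , a∈J , b∈K , a+b≈x) →
        a , b , a∈J , b∈K , ≈-trans a+b≈x x≈y
    ; 0#∈      = 0# , 0# , J.0#∈ , K.0#∈ , +-identityˡ 0#
    ; +-closed = λ (a , b , a∈J , b∈K , a+b≈x) (c , d , c∈J , d∈K , c+d≈y) →
        a + c , b + d , J.+-closed a∈J c∈J , K.+-closed b∈K d∈K ,
        ≈-trans (interchange a c b d) (+-cong a+b≈x c+d≈y)
    ; *-absorb = λ r (a , b , a∈J , b∈K , a+b≈x) →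
        r * a , r * b , J.*-absorb r a∈J , K.*-absorb r b∈K ,
        ≈-trans (≈-sym (distribˡ r a b)) (*-congˡ a+b≈x)
    }
    where
    module J = IsIdeal isIdealJ
    module K = IsIdeal isIdealK
    open CommutativeSemigroupProperties +-commutativeSemigroup using (interchange)

  ⊕-⊆ˡ : ∀ {J K} → IsIdeal K → J ⊆ J ⊕ K
  ⊕-⊆ˡ isIdealK {x} x∈J = x , 0# , x∈J , IsIdeal.0#∈ isIdealK , +-identityʳ x

  ⊕-⊆ʳ : ∀ {J K} → IsIdeal J → K ⊆ J ⊕ K
  ⊕-⊆ʳ isIdealJ {x} x∈K = 0# , x , IsIdeal.0#∈ isIdealJ , x∈K , +-identityˡ x

  ⊕-least : ∀ {J K L} → IsIdeal L → J ⊆ L → K ⊆ L → J ⊕ K ⊆ L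
  ⊕-least isIdealL J⊆L K⊆L (a , b , a∈J , b∈K , a+b≈x) =
    resp a+b≈x (+-closed (J⊆L a∈J) (K⊆L b∈K))
    where open IsIdeal isIdealL

  -- Membership in the sum replaces the universal property of a gcd: it places `g` in every ideal
  -- containing `a` and `b`, in particular in the ideal generated by any common divisor.
  HasBézoutGCDs : Set
  HasBézoutGCDs = ∀ a b → ∃ λ g →
    g ∣ a × g ∣ b × g ∈ (principalIdeal a ⊕ principalIdeal b)

-- Divisibility and gcds in the integers.

-- Reduces to absolute values in the naturals. Returning the multiples `u` and `v` instead of
-- coefficients avoids tracking the signs of `a` and `b`.
ℤ-bézoutGCD : ∀ a b → ∃ λ g → g ℤ∣.∣ a × g ℤ∣.∣ b ×
  (∃ λ u → ∃ λ v → a ℤ∣.∣ u × b ℤ∣.∣ v × u ℤ.+ v ≡ g)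
ℤ-bézoutGCD a b with Bézout.lemma ℤ.∣ a ∣ ℤ.∣ b ∣
... | Bézout.result d gcd identity =
      + d , ℤ∣.∣ᵤ⇒∣ (GCD.gcd∣m gcd) , ℤ∣.∣ᵤ⇒∣ (GCD.gcd∣n gcd) , combination identity
  where
  multiple : ∀ k x → x ℤ∣.∣ + (k ℕ.* ℤ.∣ x ∣)
  multiple k x = ℤ∣.∣ᵤ⇒∣ (n∣m*n k)

  -- Bézout's identity over the naturals avoids subtraction by moving one multiple across the
  -- equation; this moves it back.
  difference : ∀ {m k n} → m ℕ.+ k ≡ n → + n ℤ.+ ℤ.- + k ≡ + m
  difference {m} {k} refl =
    trans (ℤₚ.+-assoc (+ m) (+ k) (ℤ.- + k))
      (trans (cong (λ z → + m ℤ.+ z) (ℤₚ.+-inverseʳ (+ k))) (ℤₚ.+-identityʳ (+ m)))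

  combination : Bézout.Identity d ℤ.∣ a ∣ ℤ.∣ b ∣ →
    ∃ λ u → ∃ λ v → a ℤ∣.∣ u × b ℤ∣.∣ v × u ℤ.+ v ≡ + d
  combination (Bézout.+- x y eq) =
    _ , _ , multiple x a , ℤ∣.∣m⇒∣-m (multiple y b) , difference eq
  combination (Bézout.-+ x y eq) =
    _ , _ , ℤ∣.∣m⇒∣-m (multiple x a) , multiple y b ,
    trans (ℤₚ.+-comm (ℤ.- + (x ℕ.* ℤ.∣ a ∣)) (+ (y ℕ.* ℤ.∣ b ∣))) (difference eq)

∣i∣≡n⇒i≡±n : ∀ {i n} → ℤ.∣ i ∣ ≡ n → i ≡ + n ⊎ i ≡ ℤ.- + n
∣i∣≡n⇒i≡±n {+ _}      refl = inj₁ refl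
∣i∣≡n⇒i≡±n { -[1+ _ ]} refl = inj₂ refl

∣prime⇒±1⊎±p : ∀ {p d} → Prime p → d ℤ∣.∣ + p →
  d ≡ + 1 ⊎ d ≡ ℤ.- + 1 ⊎ d ≡ + p ⊎ d ≡ ℤ.- + p
∣prime⇒±1⊎±p prime-p d∣p with prime⇒irreducible prime-p (ℤ∣.∣⇒∣ᵤ d∣p)
... | inj₁ ∣d∣≡1 = Sum.map₂ inj₁ (∣i∣≡n⇒i≡±n ∣d∣≡1)
... | inj₂ ∣d∣≡p = inj₂ (inj₂ (∣i∣≡n⇒i≡±n ∣d∣≡p))

-- Like totalQuotient below, total with a junk value (here at n = 1), so that it
-- can be applied at every index of an ultraproduct.
∃primeDivisor : ∀ n → ∃ λ p → n ≢ 1 → Prime p × p ∣ℕ n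
∃primeDivisor 0           = 2 , λ _ → prime[2] , 2 ∣0
∃primeDivisor n@(ℕ.suc _) with factorise n
... | record { factors = []    ; isFactorisation = n≡1 } = 2 , contradiction n≡1
... | record { factors = p ∷ _ ; isFactorisation = n≡p*ps ; factorsPrime = prime-p ∷ _ } =
  p , λ _ → prime-p , subst (p ∣ℕ_) (sym n≡p*ps) (m∣m*n _)

totalQuotient : ∀ x y → ∃ λ q → x ℤ∣.∣ y → q ℤ.* x ≡ y
totalQuotient x y with x ℤ∣.∣? y
... | yes (ℤ∣.divides q y≡qx) = q , λ _ → sym y≡qx
... | no  x∤y                 = + 0 , λ x∣y → contradiction x∣y x∤y

-- Transfer to the ultrapower.

module PrimeFilters {I : Set} (𝒰 : Pred (Pred I 0ℓ) 0ℓ) (uf : IsUltrafilter 𝒰) where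
  open IsUltrafilter uf
  open Ultrapower 𝒰 uf
  open CommutativeRing *ℤ-commutativeRing using (semiring)
    renaming (sym to ≈-sym)
  open SemiringDivisibility semiring
    using (∣ʳ-refl; ∣ʳ-reflexive; ∣ʳ-trans; x∣ʳy⇒x∣ʳzy; _,_)
    renaming (_∣0 to _∣0#)
  open IdealProperties *ℤ-commutativeRing

  -- Turns a pointwise alternative, whose branch may vary with the index, into a single branch
  -- holding on a member of `𝒰`.
  ∪-prime : ∀ {A B} → (A ∪ B) ∈ 𝒰 → A ∈ 𝒰 ⊎ B ∈ 𝒰
  ∪-prime {A} A∪B∈𝒰 = Sum.map₂
    (λ ∁A∈𝒰 → upward (λ (∉A , ∈A∪B) → [ (λ ∈A → contradiction ∈A ∉A) , id ]′ ∈A∪B)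
                     (inter ∁A∈𝒰 A∪B∈𝒰))
    (ultra A)

  everywhere : ∀ {A} → (∀ i → i ∈ A) → A ∈ 𝒰
  everywhere all = upward (λ {i} _ → all i) full

  -- `totalQuotient` gives a value at every index without choice; its junk values occur only off a
  -- member of `𝒰`.
  ∣-lift : ∀ {x y} → (λ i → x i ℤ∣.∣ y i) ∈ 𝒰 → x ∣ y
  ∣-lift {x} {y} x∣y =
    (λ i → proj₁ (totalQuotient (x i) (y i))) , upward (proj₂ (totalQuotient _ _)) x∣y

  hasBézoutGCDs : HasBézoutGCDs
  hasBézoutGCDs a b =
      g , ∣-lift (everywhere (proj₁ ∘ proj₂ ∘ gcd)) , ∣-lift (everywhere (proj₁ ∘ proj₂ ∘ proj₂ ∘ gcd)) ,
      (λ i → proj₁ (combination i)) , (λ i → proj₁ (proj₂ (combination i))) ,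
      ∣-lift (everywhere (proj₁ ∘ proj₂ ∘ proj₂ ∘ combination)) ,
      ∣-lift (everywhere (proj₁ ∘ proj₂ ∘ proj₂ ∘ proj₂ ∘ combination)) ,
      everywhere (proj₂ ∘ proj₂ ∘ proj₂ ∘ proj₂ ∘ combination)
    where
    gcd = λ i → ℤ-bézoutGCD (a i) (b i)
    g = λ i → proj₁ (gcd i)
    combination = λ i → proj₂ (proj₂ (proj₂ (gcd i)))

  -- A divisor of `ι p` has four possible values at each index of a large set; three uses of
  -- `∪-prime` select one of them uniformly.
  prime⇒𝒫 : ∀ {p} → (λ i → Prime (p i)) ∈ 𝒰 → p ∈ 𝒫
  prime⇒𝒫 prime-p =
    (λ p≋1 → empty (upward (λ (prime-pᵢ , pᵢ≡1) → ¬prime[1] (subst Prime pᵢ≡1 prime-pᵢ))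
                           (inter prime-p p≋1))) ,
    (λ d (z , zd≈p) → Sum.map₂ (Sum.map₂ ∪-prime ∘ ∪-prime) (∪-prime
      (upward (λ {i} (prime-pᵢ , zᵢdᵢ≡pᵢ) → ∣prime⇒±1⊎±p prime-pᵢ (ℤ∣.divides (z i) (sym zᵢdᵢ≡pᵢ)))
              (inter prime-p zd≈p))))

  1∤ : ∀ {p} → p ∈ 𝒫 → ¬ (ι p ∣ 1#)
  1∤ (p≄1 , _) (z , zp≈1) = p≄1 (upward (λ {i} zᵢpᵢ≡1 →
    ∣1⇒≡1 (ℤ∣.∣⇒∣ᵤ (ℤ∣.divides (z i) (sym zᵢpᵢ≡1)))) zp≈1)

  -- `ultra` decides whether `n i` is 1 or -1 on a large set. If not, prime divisors chosen index by
  -- index assemble into one element of `𝒫`; where `n i` is zero, 2 serves.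
  unit⊎∃prime : ∀ n → n ∣ 1# ⊎ ∃ λ p → p ∈ pr n
  unit⊎∃prime n with ultra (λ i → ℤ.∣ n i ∣ ≡ 1)
  ... | inj₁ ∣n∣≡1 = inj₁ (∣-lift (upward (ℤ∣.∣ᵤ⇒∣ ∘ ∣-reflexive) ∣n∣≡1))
  ... | inj₂ ∣n∣≢1 = inj₂ (p , prime⇒𝒫 (upward (λ {i} → proj₁ ∘ p-spec i) ∣n∣≢1) ,
      ∣-lift (upward (λ {i} → ℤ∣.∣ᵤ⇒∣ ∘ proj₂ ∘ p-spec i) ∣n∣≢1))
    where
    p : *ℕ
    p i = proj₁ (∃primeDivisor ℤ.∣ n i ∣)
    p-spec : ∀ i → ℤ.∣ n i ∣ ≢ 1 → Prime (p i) × p i ∣ℕ ℤ.∣ n i ∣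
    p-spec i = proj₂ (∃primeDivisor ℤ.∣ n i ∣)

  pr⊆∅⇒unit : ∀ {n} → pr n ⊆ ∅ → n ∣ 1#
  pr⊆∅⇒unit {n} pr⊆∅ = [ id , (λ (_ , p∈pr) → contradiction p∈pr pr⊆∅) ]′ (unit⊎∃prime n)

  -- Sets of prime divisors.

  pr-⊆ : ∀ {n m} → n ∣ m → pr n ⊆ pr m
  pr-⊆ n∣m (p∈𝒫 , p∣n) = p∈𝒫 , ∣ʳ-trans p∣n n∣m

  pr-cong : ∀ {n m} → n ≈ m → pr n ≐ pr m
  pr-cong n≈m = pr-⊆ (∣ʳ-reflexive n≈m) , pr-⊆ (∣ʳ-reflexive (≈-sym n≈m))

  pr1⊆∅ : pr 1# ⊆ ∅
  pr1⊆∅ (p∈𝒫 , p∣1) = 1∤ p∈𝒫 p∣1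

  pr0⊈∅ : ¬ (pr 0# ⊆ ∅)
  pr0⊈∅ pr0⊆∅ = pr0⊆∅ {λ _ → 2} (prime⇒𝒫 (everywhere λ _ → prime[2]) , _ ∣0#)

  pr[gcd] : ∀ n m → ∃ λ g → pr g ≐ pr n ∩ pr m ×
    (∀ {J} → IsIdeal J → n ∈ J → m ∈ J → g ∈ J)
  pr[gcd] n m with hasBézoutGCDs n m
  ... | g , g∣n , g∣m , g∈n⊕m =
      g , ((λ p∈ → pr-⊆ g∣n p∈ , pr-⊆ g∣m p∈) ,
           -- For the reverse inclusion, `g∈` is applied to the ideal generated by `ι p`.
           λ ((p∈𝒫 , p∣n) , (_ , p∣m)) → p∈𝒫 , g∈ (principalIdeal-isIdeal _) p∣n p∣m) ,
      g∈
    where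
    g∈ : ∀ {J} → IsIdeal J → n ∈ J → m ∈ J → g ∈ J
    g∈ isIdeal n∈J m∈J =
      ⊕-least isIdeal (λ n∣x → ∣-closed isIdeal n∣x n∈J) (λ m∣x → ∣-closed isIdeal m∣x m∈J) g∈n⊕m

  ∩-∈pr[*ℤ] : ∀ {S T} → S ∈ pr[*ℤ] → T ∈ pr[*ℤ] → (S ∩ T) ∈ pr[*ℤ]
  ∩-∈pr[*ℤ] (n , S≐prn) (m , T≐prm) with pr[gcd] n m
  ... | g , prg≐ , _ = g , ≐-trans (∩-cong S≐prn T≐prm) (≐-sym prg≐)

  -- From maximal ideals to maximal filters.

  module _ {𝔪} (isMaximal : IsMaximalIdeal 𝔪) where
    open IsMaximalIdeal isMaximal

    -- By maximality it suffices that `𝔪 ⊕ principalIdeal n` is proper. If 1 were `a + b` there, a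
    -- common prime of `a` and `n` would divide 1, so `pr a` and `pr n` would be disjoint.
    meets-𝔪⇒∈𝔪 : ∀ {n} → (∀ {a} → a ∈ 𝔪 → ¬ (pr a ∩ pr n ⊆ ∅)) → n ∈ 𝔪
    meets-𝔪⇒∈𝔪 {n} meets =
      maximal (⊕-isIdeal isIdeal ⟨n⟩-isIdeal) 1∉𝔪⊕n (⊕-⊆ˡ ⟨n⟩-isIdeal) (⊕-⊆ʳ isIdeal ∣ʳ-refl)
      where
      ⟨n⟩-isIdeal = principalIdeal-isIdeal n
      1∉𝔪⊕n : ¬ (1# ∈ 𝔪 ⊕ principalIdeal n)
      1∉𝔪⊕n (a , b , a∈𝔪 , n∣b , a+b≈1) =
        meets a∈𝔪 λ {p} ((p∈𝒫 , p∣a) , (_ , p∣n)) → 1∤ p∈𝒫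
          (IsIdeal.resp (⟨p⟩ p) a+b≈1 (IsIdeal.+-closed (⟨p⟩ p) p∣a (∣ʳ-trans p∣n n∣b)))
        where ⟨p⟩ = λ p → principalIdeal-isIdeal (ι p)

    pr-nonempty : ∀ {n} → n ∈ 𝔪 → ¬ (pr n ⊆ ∅)
    pr-nonempty n∈𝔪 prn⊆∅ = proper (∣-closed isIdeal (pr⊆∅⇒unit prn⊆∅) n∈𝔪)

    pr-upward : ∀ {n m} → n ∈ 𝔪 → pr n ⊆ pr m → m ∈ 𝔪
    pr-upward {n} n∈𝔪 prn⊆prm = meets-𝔪⇒∈𝔪 λ {a} a∈𝔪 disjoint →
      let g , (prg⊆ , _) , g∈ = pr[gcd] a n in
      pr-nonempty (g∈ isIdeal a∈𝔪 n∈𝔪)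
        (λ p∈ → let p∈pra , p∈prn = prg⊆ p∈ in disjoint (p∈pra , prn⊆prm p∈prn))

    -- `𝓕 𝔪` records only that some `m` in `𝔪` has the same primes as `n`; `pr-upward` passes from
    -- `m` to `n`.
    𝓕⁻ : ∀ {n} → pr n ∈ 𝓕 𝔪 → n ∈ 𝔪
    𝓕⁻ (_ , m∈𝔪 , _ , prm⊆prn) = pr-upward m∈𝔪 prm⊆prn

    𝓕-isFilter : IsFilter (𝓕 𝔪)
    𝓕-isFilter = record
      { ⊆pr[*ℤ]  = λ (n , _ , S≐prn) → n , S≐prn
      ; resp     = λ S≐T (n , n∈𝔪 , S≐prn) → n , n∈𝔪 , ≐-trans (≐-sym S≐T) S≐prn
      ; ∅∉       = λ (n , n∈𝔪 , _ , prn⊆∅) → pr-nonempty n∈𝔪 prn⊆∅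
      ; ∩-closed = λ (n , n∈𝔪 , S≐prn) (m , m∈𝔪 , T≐prm) →
          let g , prg≐ , g∈ = pr[gcd] n m in
          g , g∈ isIdeal n∈𝔪 m∈𝔪 , ≐-trans (∩-cong S≐prn T≐prm) (≐-sym prg≐)
      ; upward   = λ {_} {m} prn∈ prn⊆prm →
          m , pr-upward (𝓕⁻ prn∈) prn⊆prm , ≐-refl
      }

    𝓕-isMaximalFilter : IsMaximalFilter (𝓕 𝔪)
    𝓕-isMaximalFilter = record
      { isFilter = 𝓕-isFilter
      ; maximal  = λ isFilter 𝓕⊆𝒢 S∈𝒢 →
          let open IsFilter isFilter
              n , S≐prn = ⊆pr[*ℤ] S∈𝒢
          -- `pr n` and every such `pr a` lie in the one filter `𝒢`, so their intersection cannot be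
          -- empty.
          in n , meets-𝔪⇒∈𝔪 (λ {a} a∈𝔪 disjoint → ∅∉ (IsFilter.resp isFilter
                   (disjoint , λ ())
                   (∩-closed (𝓕⊆𝒢 (a , a∈𝔪 , ≐-refl)) (IsFilter.resp isFilter S≐prn S∈𝒢)))) ,
             S≐prn
      }

    𝓕-principal⇒ : IsPrincipal (𝓕 𝔪) → ∃ λ p → p ∈ 𝒫 × 𝔪 ≐ principalIdeal (ι p)
    𝓕-principal⇒ (n , generates) =
      [ (λ n∣1 → contradiction (∣-closed isIdeal n∣1 n∈𝔪) proper)
      , (λ (p , p∈𝒫 , p∣n) →
          let 𝔪⊆⟨p⟩ : 𝔪 ⊆ principalIdeal (ι p)
              𝔪⊆⟨p⟩ m∈𝔪 = proj₂ (prn⊆pr m∈𝔪 (p∈𝒫 , p∣n))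
          in p , p∈𝒫 , 𝔪⊆⟨p⟩ ,
             maximal (principalIdeal-isIdeal (ι p)) (1∤ p∈𝒫) 𝔪⊆⟨p⟩)
      ]′ (unit⊎∃prime n)
      where
      n∈𝔪 : n ∈ 𝔪
      n∈𝔪 = 𝓕⁻ (Equivalence.from (generates (pr n) (n , ≐-refl)) id)
      prn⊆pr : ∀ {m} → m ∈ 𝔪 → pr n ⊆ pr m
      prn⊆pr {m} m∈𝔪 = Equivalence.to (generates (pr m) (m , ≐-refl)) (m , m∈𝔪 , ≐-refl)

    ⇒𝓕-principal : (∃ λ p → p ∈ 𝒫 × 𝔪 ≐ principalIdeal (ι p)) → IsPrincipal (𝓕 𝔪)
    ⇒𝓕-principal (p , p∈𝒫 , 𝔪⊆⟨p⟩ , ⟨p⟩⊆𝔪) = ι p , λ S (m , S⊆prm , prm⊆S) → mk⇔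
      (λ (n , n∈𝔪 , _ , prn⊆S) q∈ → prn⊆S (pr-⊆ (𝔪⊆⟨p⟩ n∈𝔪) q∈))
      -- `p` itself lies in `pr (ι p)`, hence in `S`, so `ι p` divides `m`.
      (λ prp⊆S → m , ⟨p⟩⊆𝔪 (proj₂ (S⊆prm (prp⊆S (p∈𝒫 , ∣ʳ-refl)))) , S⊆prm , prm⊆S)

  𝓕-mono : ∀ {J K} → J ⊆ K → 𝓕 J ⊆ 𝓕 K
  𝓕-mono J⊆K (n , n∈J , S≐prn) = n , J⊆K n∈J , S≐prn

  𝓕-cancel-⊆ : ∀ {𝔪 𝔫} → IsMaximalIdeal 𝔫 → 𝓕 𝔪 ⊆ 𝓕 𝔫 → 𝔪 ⊆ 𝔫
  𝓕-cancel-⊆ isMaximal 𝓕⊆ {n} n∈𝔪 = 𝓕⁻ isMaximal (𝓕⊆ (n , n∈𝔪 , ≐-refl))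

  -- From maximal filters to maximal ideals.

  module _ {ℱ} (isMaximalFilter : IsMaximalFilter ℱ) where
    open IsMaximalFilter isMaximalFilter
    private module ℱ = IsFilter isFilter

    -- The empty family is a filter, so maximality is needed here.
    pr0∈ : pr 0# ∈ ℱ
    pr0∈ = maximal {λ S → S ∈ ℱ ⊎ S ≐ pr 0#} (record
      { ⊆pr[*ℤ]  = [ ℱ.⊆pr[*ℤ] , (λ S≐pr0 → 0# , S≐pr0) ]′
      ; resp     = λ S≐T → Sum.map (ℱ.resp S≐T) (≐-trans (≐-sym S≐T))
      ; ∅∉       = [ ℱ.∅∉ , (λ (_ , pr0⊆∅) → pr0⊈∅ pr0⊆∅) ]′
      ; ∩-closed = λ where
          (inj₁ S∈)    (inj₁ T∈)    → inj₁ (ℱ.∩-closed S∈ T∈)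
          (inj₁ S∈)    (inj₂ T≐pr0) → inj₁ (ℱ.resp (≐-sym (∩-pr0 S∈ T≐pr0)) S∈)
          (inj₂ S≐pr0) (inj₁ T∈)    →
            inj₁ (ℱ.resp (≐-trans (≐-sym (∩-pr0 T∈ S≐pr0)) (∩-comm _ _)) T∈)
          (inj₂ S≐pr0) (inj₂ T≐pr0) →
            inj₂ (≐-trans (∩-cong S≐pr0 T≐pr0) (proj₁ , λ p∈ → p∈ , p∈))
      ; upward   = λ where
          (inj₁ prn∈)         prn⊆prm → inj₁ (ℱ.upward prn∈ prn⊆prm)
          (inj₂ (_ , pr0⊆prn)) prn⊆prm → inj₂ (pr-⊆ (_ ∣0#) , prn⊆prm ∘ pr0⊆prn)
      }) inj₁ (inj₂ ≐-refl)
      where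
      -- `pr 0#` is all of `𝒫`, the largest set in `pr[*ℤ]`, so intersecting with it changes
      -- nothing.
      ∩-pr0 : ∀ {S T} → S ∈ ℱ → T ≐ pr 0# → S ∩ T ≐ S
      ∩-pr0 S∈ (_ , pr0⊆T) =
        proj₁ , λ p∈ → p∈ , pr0⊆T (pr-⊆ (_ ∣0#) (proj₁ (proj₂ (ℱ.⊆pr[*ℤ] S∈)) p∈))

    𝓕⁻¹ : Pred *ℤ 0ℓ
    𝓕⁻¹ n = pr n ∈ ℱ

    𝓕⁻¹-isIdeal : IsIdeal 𝓕⁻¹
    𝓕⁻¹-isIdeal = record
      { resp     = λ n≈m → ℱ.resp (pr-cong n≈m)
      ; 0#∈      = pr0∈
      ; +-closed = λ {n} {m} prn∈ prm∈ →
          -- `ℱ.upward` compares only sets of the form `pr`, so the intersection is first rewritten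
          -- as `pr g`.
          let g , prg≐ , _ = pr[gcd] n m in
          ℱ.upward (ℱ.resp (≐-sym prg≐) (ℱ.∩-closed prn∈ prm∈))
            (λ p∈ → let (p∈𝒫 , p∣n) , (_ , p∣m) = proj₁ prg≐ p∈ in
               p∈𝒫 , IsIdeal.+-closed (principalIdeal-isIdeal _) p∣n p∣m)
      ; *-absorb = λ r prn∈ → ℱ.upward prn∈ (pr-⊆ (x∣ʳy⇒x∣ʳzy r ∣ʳ-refl))
      }

    𝓕⁻¹-isMaximalIdeal : IsMaximalIdeal 𝓕⁻¹
    𝓕⁻¹-isMaximalIdeal = record
      { isIdeal = 𝓕⁻¹-isIdeal
      ; proper  = λ pr1∈ → ℱ.∅∉ (ℱ.resp (pr1⊆∅ , λ ()) pr1∈)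
      ; maximal = λ {K} isIdeal 1∉K 𝓕⁻¹⊆K {n} n∈K → maximal
          -- The upward closure of the sets `pr k` with `k` in `K`: closure under supersets then
          -- holds by construction, though `K` is only known to be a proper ideal.
          {λ S → S ∈ pr[*ℤ] × ∃ λ k → k ∈ K × pr k ⊆ S}
          (record
            { ⊆pr[*ℤ]  = proj₁
            ; resp     = λ S≐T ((m , S≐prm) , k , k∈K , prk⊆S) →
                (m , ≐-trans (≐-sym S≐T) S≐prm) , k , k∈K , proj₁ S≐T ∘ prk⊆S
            ; ∅∉       = λ (_ , k , k∈K , prk⊆∅) →
                1∉K (∣-closed isIdeal (pr⊆∅⇒unit prk⊆∅) k∈K)
            ; ∩-closed = λ (S∈ , k , k∈K , prk⊆S) (T∈ , l , l∈K , prl⊆T) →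
                let g , (prg⊆ , _) , g∈ = pr[gcd] k l in
                ∩-∈pr[*ℤ] S∈ T∈ , g , g∈ isIdeal k∈K l∈K ,
                λ p∈ → map prk⊆S prl⊆T (prg⊆ p∈)
            ; upward   = λ {_} {m} (_ , k , k∈K , prk⊆prn) prn⊆prm →
                (m , ≐-refl) , k , k∈K , prn⊆prm ∘ prk⊆prn
            })
          (λ S∈ → let m , S≐prm = ℱ.⊆pr[*ℤ] S∈ in
            (m , S≐prm) , m , 𝓕⁻¹⊆K (ℱ.resp S≐prm S∈) , proj₂ S≐prm)
          ((n , ≐-refl) , n , n∈K , id)
      }

    𝓕-𝓕⁻¹ : 𝓕 𝓕⁻¹ ≐ ℱ
    𝓕-𝓕⁻¹ =
      (λ (_ , prn∈ , S≐prn) → ℱ.resp (≐-sym S≐prn) prn∈) ,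
      (λ S∈ → let n , S≐prn = ℱ.⊆pr[*ℤ] S∈ in n , ℱ.resp S≐prn S∈ , S≐prn)

  -- The bijection, up to extensional equality.

  𝓕-isBijection : IsBijection _≐ᴵ_ _≐ᶠ_ (map 𝓕 𝓕-isMaximalFilter)
  𝓕-isBijection = record
    { isInjection = record
      { isCongruent = record
        { cong           = λ (𝔪⊆𝔫 , 𝔫⊆𝔪) → 𝓕-mono 𝔪⊆𝔫 , 𝓕-mono 𝔫⊆𝔪
        ; isEquivalence₁ = record { refl = ≐-refl ; sym = ≐-sym ; trans = ≐-trans }
        ; isEquivalence₂ = record { refl = ≐-refl ; sym = ≐-sym ; trans = ≐-trans }
        }
      ; injective = λ { {_ , 𝔪-maximal} {_ , 𝔫-maximal} (𝓕𝔪⊆𝓕𝔫 , 𝓕𝔫⊆𝓕𝔪) →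
          𝓕-cancel-⊆ 𝔫-maximal 𝓕𝔪⊆𝓕𝔫 , 𝓕-cancel-⊆ 𝔪-maximal 𝓕𝔫⊆𝓕𝔪 }
      }
    ; surjective = λ (ℱ , ℱ-maximal) →
        (𝓕⁻¹ ℱ-maximal , 𝓕⁻¹-isMaximalIdeal ℱ-maximal) ,
        -- Setoid surjectivity asks that every maximal ideal equal to the chosen preimage be sent to
        -- `ℱ`.
        λ (𝔪⊆ , ⊆𝔪) → ≐-trans (𝓕-mono 𝔪⊆ , 𝓕-mono ⊆𝔪) (𝓕-𝓕⁻¹ ℱ-maximal)
    }

theorem4p6 :
    (I : Set) → I ⤖ ℕ →
    (𝒰 : Pred (Pred I 0ℓ) 0ℓ) (uf : IsUltrafilter 𝒰) → Nonprincipal 𝒰 →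
    let open Ultrapower 𝒰 uf in
    Σ (∀ {𝔪} → IsMaximalIdeal 𝔪 → IsMaximalFilter (𝓕 𝔪)) (λ 𝓕-maximal →
      IsBijection _≐ᴵ_ _≐ᶠ_ (map 𝓕 𝓕-maximal))
    × (∀ {𝔪} → IsMaximalIdeal 𝔪 →
        IsPrincipal (𝓕 𝔪) ⇔ (∃ λ p → p ∈ 𝒫 × 𝔪 ≐ principalIdeal (ι p)))
theorem4p6 I _ 𝒰 uf _ =
  (𝓕-isMaximalFilter , 𝓕-isBijection) ,
  λ isMaximal → mk⇔ (𝓕-principal⇒ isMaximal) (⇒𝓕-principal isMaximal)
  where open PrimeFilters 𝒰 uf
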